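{- Suppose that $\mu$ is a non-atomic strictly positive measure on a Boolean algebra $\mathfrak{B}$. Then there is a partition of unity $\{a_n\colon n<\omega\}$ such that for every $n$ and every $\mathbf{0}\neq b\le a_n$ we have $\mathrm{ur}(\mu\,|\,b)=\mathrm{ur}(\mu\,|\,a_n)$.
   Context: A measure on a Boolean algebra is a finitely additive non-negative finite function, normalized to have value $1$ at the unit; it is non-atomic if for every $\varepsilon>0$ there is a finite partition of unity into elements of measure at most $\varepsilon$. A partition of unity is a maximal antichain (family of pairwise disjoint elements with supremum $\mathbf{1}$). A family $\mathcal{F}\subseteq\mathfrak{B}$ is uniformly $\mu$-dense if for every $b\in\mathfrak{B}$ and $\varepsilon>0$ there is $a\in\mathcal{F}$ with $a\le b$ and $\mu(b\setminus a)<\varepsilon$. $\mathrm{ur}(\mu)$ is the least cardinality of a uniformly $\mu$-dense family $\mathcal{F}\subseteq\mathfrak{B}$. For $b\neq\mathbf{0}$, $\mu\,|\,b$ denotes the restriction of $\mu$ to the relative algebra $\{c\in\mathfrak{B}:c\le b\}$ (normalization does not affect $\mathrm{ur}$). -}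

module Defs where

open import Algebra.Lattice.Bundles using (BooleanAlgebra)
import Algebra.Lattice.Properties.BooleanAlgebra as BooleanAlgebraProperties
open import Data.Fin.Base using (Fin)
open import Data.Nat.Base using (ℕ)
open import Data.Product.Base using (Σ; ∃; ∃₂; _×_; _,_; proj₁; proj₂)
open import Data.Rational.Base as ℚ using (ℚ; 0ℚ; 1ℚ)
import Data.Rational.Properties as ℚ
open import Function.Base using (_∘_)
open import Function.Bundles using (Func; Injection; Inverse; _⟨$⟩_)
open import Level using (Level; _⊔_; suc)
open import Relation.Binary.Bundles using (Poset; Setoid)
import Relation.Binary.Construct.On as On
open import Relation.Binary.Definitions using (tri<; tri≈; tri>)
import Relation.Binary.Lattice.Bundles as OrderTheoretic
open import Relation.Binary.PropositionalEquality using (_≡_; _≢_; refl; sym; cong; subst; module ≡-Reasoning)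
import Relation.Binary.Reasoning.Setoid as SetoidReasoning
open import Relation.Nullary.Negation using (¬_; contradiction)
open import Relation.Unary using (Pred)

-- The axiom of choice with setoids in the role of sets.  The values are
-- already given by the untruncated ∃; the content is that they can be chosen
-- so as to respect the equality of X.

AxiomOfChoice : ∀ a ℓ₁ b ℓ₂ r → Set (suc (a ⊔ ℓ₁ ⊔ b ⊔ ℓ₂ ⊔ r))
AxiomOfChoice a ℓ₁ b ℓ₂ r =
  (X : Setoid a ℓ₁) (Y : Setoid b ℓ₂) →
  let module X = Setoid X
      module Y = Setoid Y in
  (R : X.Carrier → Y.Carrier → Set r) →
  (∀ {x x′ y y′} → x X.≈ x′ → y Y.≈ y′ → R x y → R x′ y′) →
  (∀ x → ∃ λ y → R x y) →
  ∃ λ (f : Func X Y) → ∀ x → R x (f ⟨$⟩ x)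

-- Real numbers as (lower) Dedekind cuts.  In the presence of excluded middle
-- these are the usual reals.

record ℝ : Set₁ where
  field
    cut       : ℚ → Set
    inhabited : ∃ λ q → cut q
    proper    : ∃ λ q → ¬ cut q
    down      : ∀ {p q} → p ℚ.< q → cut q → cut p
    rounded   : ∀ {p} → cut p → ∃ λ q → p ℚ.< q × cut q

open ℝ using (cut)

infix 4 _≤ᵣ_ _<ᵣ_ _≃ᵣ_
infixl 6 _+ᵣ_

_≤ᵣ_ : ℝ → ℝ → Set
x ≤ᵣ y = ∀ q → cut x q → cut y q

_≃ᵣ_ : ℝ → ℝ → Set
x ≃ᵣ y = x ≤ᵣ y × y ≤ᵣ x

_<ᵣ_ : ℝ → ℝ → Set
x <ᵣ y = x ≤ᵣ y × ¬ (y ≤ᵣ x)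

fromℚ : ℚ → ℝ
fromℚ r = record
  { cut       = λ q → q ℚ.< r
  ; inhabited = r ℚ.- 1ℚ , subst (r ℚ.- 1ℚ ℚ.<_) (ℚ.+-identityʳ r)
                             (ℚ.+-monoʳ-< r (ℚ.negative⁻¹ (ℚ.- 1ℚ)))
  ; proper    = r , ℚ.<-irrefl refl
  ; down      = ℚ.<-trans
  ; rounded   = ℚ.<-dense
  }

0ᵣ 1ᵣ : ℝ
0ᵣ = fromℚ 0ℚ
1ᵣ = fromℚ 1ℚ

cut-bound : ∀ (x : ℝ) {p q} → cut x p → ¬ cut x q → p ℚ.< q
cut-bound x {p} {q} p∈x q∉x with ℚ.<-cmp p q
... | tri< p<q _ _    = p<q
... | tri≈ _ refl _   = contradiction p∈x q∉x
... | tri> _ _ q<p    = contradiction (ℝ.down x q<p p∈x) q∉x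

_+ᵣ_ : ℝ → ℝ → ℝ
x +ᵣ y = record
  { cut       = λ q → ∃₂ λ r s → cut x r × cut y s × q ≡ r ℚ.+ s
  ; inhabited = let r , r∈x = ℝ.inhabited x
                    s , s∈y = ℝ.inhabited y
                in r ℚ.+ s , r , s , r∈x , s∈y , refl
  ; proper    = let r , r∉x = ℝ.proper x
                    s , s∉y = ℝ.proper y
                in r ℚ.+ s , λ (r′ , s′ , r′∈x , s′∈y , eq) →
                     ℚ.<-irrefl (sym eq)
                       (ℚ.+-mono-< (cut-bound x r′∈x r∉x) (cut-bound y s′∈y s∉y))
  ; down      = λ { {p} p<q (r , s , r∈x , s∈y , refl) →
                  r , p ℚ.- r , r∈x , ℝ.down y (p-r<s p<q) s∈y , sym (r+[p-r]≡p r p) }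
  ; rounded   = λ { (r , s , r∈x , s∈y , refl) →
                  let r′ , r<r′ , r′∈x = ℝ.rounded x r∈x
                  in r′ ℚ.+ s , ℚ.+-monoˡ-< s r<r′ , r′ , s , r′∈x , s∈y , refl }
  }
  where
  open ≡-Reasoning

  [r+s]-r≡s : ∀ r s → (r ℚ.+ s) ℚ.- r ≡ s
  [r+s]-r≡s r s = begin
    (r ℚ.+ s) ℚ.- r   ≡⟨ cong (ℚ._- r) (ℚ.+-comm r s) ⟩
    (s ℚ.+ r) ℚ.- r   ≡⟨ ℚ.+-assoc s r (ℚ.- r) ⟩
    s ℚ.+ (r ℚ.- r)   ≡⟨ cong (s ℚ.+_) (ℚ.+-inverseʳ r) ⟩
    s ℚ.+ 0ℚ          ≡⟨ ℚ.+-identityʳ s ⟩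
    s                 ∎

  r+[p-r]≡p : ∀ r p → r ℚ.+ (p ℚ.- r) ≡ p
  r+[p-r]≡p r p = begin
    r ℚ.+ (p ℚ.- r)   ≡⟨ ℚ.+-assoc r p (ℚ.- r) ⟨
    (r ℚ.+ p) ℚ.- r   ≡⟨ [r+s]-r≡s r p ⟩
    p                 ∎

  p-r<s : ∀ {p r s} → p ℚ.< r ℚ.+ s → p ℚ.- r ℚ.< s
  p-r<s {p} {r} {s} p<r+s =
    subst (p ℚ.- r ℚ.<_) ([r+s]-r≡s r s) (ℚ.+-monoˡ-< (ℚ.- r) p<r+s)

module Order {c ℓ} (𝔅 : BooleanAlgebra c ℓ) where
  open BooleanAlgebra 𝔅 hiding (¬_)
  open BooleanAlgebraProperties 𝔅 using (poset)
  open Poset poset public using (_≤_)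

  infixl 7 _∖_
  _∖_ : Carrier → Carrier → Carrier
  x ∖ y = x ∧ BooleanAlgebra.¬_ 𝔅 y

  IsSupremum : {I : Set} → (I → Carrier) → Carrier → Set (c ⊔ ℓ)
  IsSupremum a s = (∀ i → a i ≤ s) × (∀ u → (∀ i → a i ≤ u) → s ≤ u)

  record IsPartitionOfUnity {I : Set} (a : I → Carrier) : Set (c ⊔ ℓ) where
    field
      nonzero  : ∀ i → a i ≉ ⊥
      disjoint : ∀ i j → i ≢ j → a i ∧ a j ≈ ⊥
      supremum : IsSupremum a ⊤

  -- A subset of 𝔅 as a set in its own right.

  ⟪_⟫ : Pred Carrier (c ⊔ ℓ) → Setoid (c ⊔ ℓ) ℓ
  ⟪ F ⟫ = On.setoid {B = Σ Carrier F} setoid proj₁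

-- Not required to be normalized, so that restrictions to relative algebras
-- are again of this kind.

record FiniteMeasure {c ℓ} (𝔅 : BooleanAlgebra c ℓ) : Set (suc Level.zero ⊔ c ⊔ ℓ) where
  open BooleanAlgebra 𝔅 hiding (¬_)
  field
    μ        : Carrier → ℝ
    μ-cong   : ∀ {x y} → x ≈ y → μ x ≃ᵣ μ y
    nonneg   : ∀ x → 0ᵣ ≤ᵣ μ x
    additive : ∀ x y → x ∧ y ≈ ⊥ → μ (x ∨ y) ≃ᵣ μ x +ᵣ μ y

record Measure {c ℓ} (𝔅 : BooleanAlgebra c ℓ) : Set (suc Level.zero ⊔ c ⊔ ℓ) where
  field
    finiteMeasure : FiniteMeasure 𝔅
  open FiniteMeasure finiteMeasure public
  field
    normalized : μ (BooleanAlgebra.⊤ 𝔅) ≃ᵣ 1ᵣ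

module _ {c ℓ} {𝔅 : BooleanAlgebra c ℓ} (m : Measure 𝔅) where
  open BooleanAlgebra 𝔅 hiding (¬_)
  open Order 𝔅
  open Measure m

  StrictlyPositive : Set (c ⊔ ℓ)
  StrictlyPositive = ∀ x → x ≉ ⊥ → 0ᵣ <ᵣ μ x

  NonAtomic : Set (suc Level.zero ⊔ c ⊔ ℓ)
  NonAtomic = ∀ ε → 0ᵣ <ᵣ ε →
    ∃ λ n → ∃ λ (p : Fin n → Carrier) →
      IsPartitionOfUnity p × (∀ i → μ (p i) ≤ᵣ ε)

module _ {c ℓ} {𝔅 : BooleanAlgebra c ℓ} (m : FiniteMeasure 𝔅) where
  open BooleanAlgebra 𝔅 hiding (¬_)
  open Order 𝔅
  open FiniteMeasure m

  UniformlyDense : Pred Carrier (c ⊔ ℓ) → Set (suc Level.zero ⊔ c ⊔ ℓ)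
  UniformlyDense F = ∀ b ε → 0ᵣ <ᵣ ε →
    ∃ λ a → F a × a ≤ b × μ (b ∖ a) <ᵣ ε

  -- Cardinal numbers are represented by setoids: equality of cardinals is
  -- Inverse and ≤ is Injection.  IsUr κ says that κ represents ur(μ).

  IsUr : Setoid (c ⊔ ℓ) ℓ → Set (suc (c ⊔ ℓ))
  IsUr κ =
    (∃ λ F → UniformlyDense F × Inverse κ ⟪ F ⟫) ×
    (∀ F → UniformlyDense F → Injection κ ⟪ F ⟫)

module Relative {c ℓ} (𝔅 : BooleanAlgebra c ℓ) (b : BooleanAlgebra.Carrier 𝔅) where
  open BooleanAlgebra 𝔅 renaming (¬_ to ∁_; refl to ≈-refl; sym to ≈-sym; trans to ≈-trans)
  open BooleanAlgebraProperties 𝔅 hiding (poset)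
  open OrderTheoretic.Lattice ∨-∧-orderTheoreticLattice
    using (_≤_; x∧y≤x; ∨-least)
    renaming (refl to ≤-refl; trans to ≤-trans)

  relative : BooleanAlgebra (c ⊔ ℓ) ℓ
  relative = record
    { Carrier = Σ Carrier (_≤ b)
    ; _≈_     = λ (x , _) (y , _) → x ≈ y
    ; _∨_     = λ (x , x≤b) (y , y≤b) → x ∨ y , ∨-least x≤b y≤b
    ; _∧_     = λ (x , x≤b) (y , _) → x ∧ y , ≤-trans (x∧y≤x x y) x≤b
    ; ¬_      = λ (x , _) → b ∧ ∁ x , x∧y≤x b (∁ x)
    ; ⊤       = b , ≤-refl
    ; ⊥       = ⊥ , ≈-sym (∧-zeroˡ b)
    ; isBooleanAlgebra = record
      { isDistributiveLattice = record
        { isLattice = record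
          { isEquivalence = On.isEquivalence proj₁ isEquivalence
          ; ∨-comm        = λ (x , _) (y , _) → ∨-comm x y
          ; ∨-assoc       = λ (x , _) (y , _) (z , _) → ∨-assoc x y z
          ; ∨-cong        = ∨-cong
          ; ∧-comm        = λ (x , _) (y , _) → ∧-comm x y
          ; ∧-assoc       = λ (x , _) (y , _) (z , _) → ∧-assoc x y z
          ; ∧-cong        = ∧-cong
          ; absorptive    = (λ (x , _) (y , _) → ∨-absorbs-∧ x y)
                          , (λ (x , _) (y , _) → ∧-absorbs-∨ x y)
          }
        ; ∨-distrib-∧ = (λ (x , _) (y , _) (z , _) → ∨-distribˡ-∧ x y z)
                      , (λ (x , _) (y , _) (z , _) → ∨-distribʳ-∧ x y z)
        ; ∧-distrib-∨ = (λ (x , _) (y , _) (z , _) → ∧-distribˡ-∨ x y z)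
                      , (λ (x , _) (y , _) (z , _) → ∧-distribʳ-∨ x y z)
        }
      ; ∨-complement = (λ (x , x≤b) → ≈-trans (∨-comm _ x) (join x x≤b))
                     , (λ (x , x≤b) → join x x≤b)
      ; ∧-complement = (λ (x , _) → ≈-trans (∧-comm _ x) (meet x))
                     , (λ (x , _) → meet x)
      ; ¬-cong       = λ x≈y → ∧-congˡ (¬-cong x≈y)
      }
    }
    where
    open SetoidReasoning setoid

    join : ∀ x → x ≤ b → x ∨ (b ∧ ∁ x) ≈ b
    join x x≤b = begin
      x ∨ (b ∧ ∁ x)        ≈⟨ ∨-distribˡ-∧ x b (∁ x) ⟩
      (x ∨ b) ∧ (x ∨ ∁ x)  ≈⟨ ∧-congˡ (∨-complementʳ x) ⟩
      (x ∨ b) ∧ ⊤          ≈⟨ ∧-identityʳ (x ∨ b) ⟩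
      x ∨ b                ≈⟨ ∨-congʳ x≤b ⟩
      (x ∧ b) ∨ b          ≈⟨ ∨-comm (x ∧ b) b ⟩
      b ∨ (x ∧ b)          ≈⟨ ∨-congˡ (∧-comm x b) ⟩
      b ∨ (b ∧ x)          ≈⟨ ∨-absorbs-∧ b x ⟩
      b                    ∎

    meet : ∀ x → x ∧ (b ∧ ∁ x) ≈ ⊥
    meet x = begin
      x ∧ (b ∧ ∁ x)        ≈⟨ ∧-congˡ (∧-comm b (∁ x)) ⟩
      x ∧ (∁ x ∧ b)        ≈⟨ ∧-assoc x (∁ x) b ⟨
      (x ∧ ∁ x) ∧ b        ≈⟨ ∧-congʳ (∧-complementʳ x) ⟩
      ⊥ ∧ b                ≈⟨ ∧-zeroˡ b ⟩
      ⊥                    ∎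

  restrict : FiniteMeasure 𝔅 → FiniteMeasure relative
  restrict m = record
    { μ        = μ ∘ proj₁
    ; μ-cong   = μ-cong
    ; nonneg   = λ (x , _) → nonneg x
    ; additive = λ (x , _) (y , _) → additive x y
    }
    where open FiniteMeasure m

infixl 6 _∣_
_∣_ : ∀ {c ℓ} {𝔅 : BooleanAlgebra c ℓ} → Measure 𝔅 →
      (b : BooleanAlgebra.Carrier 𝔅) → FiniteMeasure (Relative.relative 𝔅 b)
_∣_ {𝔅 = 𝔅} m b = Relative.restrict 𝔅 b (Measure.finiteMeasure m)

-- ur(μ|a) = ur(μ|b), including that both exist.

SameUr : ∀ {c ℓ} {𝔅 : BooleanAlgebra c ℓ} → Measure 𝔅 →
         (a b : BooleanAlgebra.Carrier 𝔅) → Set (suc (c ⊔ ℓ))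
SameUr m a b = ∃ λ κ → IsUr (m ∣ a) κ × IsUr (m ∣ b) κ

{-# OPTIONS --safe #-}
-- Cardinals are well-ordered, so below every nonzero element there is a nonzero
-- b at which ur(μ∣b) is least.  A dense family in b restricts to its members
-- below any b′ ≤ b, hence ur(μ∣_) is constant below b: such homogeneous elements
-- are order-dense.  The partition consists of homogeneous elements chosen
-- greedily by measure: each aₙ is proper in what is left over and exceeds
-- 1/(k+1) whenever some candidate does.  A nonzero element disjoint from all aₙ
-- would contain a candidate for every stage, so that all the measures μ(aₙ)
-- would exceed a fixed 1/(k+1), which is impossible in a total mass of 1.
module Submission where

open import Defs
open import Algebra.Lattice.Bundles using (BooleanAlgebra)
import Algebra.Lattice.Properties.BooleanAlgebra as BooleanAlgebraProperties
open import Axiom.ExcludedMiddle using (ExcludedMiddle)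
open import Data.Bool.Base using (Bool; T)
import Data.Integer.Base as ℤ
import Data.Integer.Properties as ℤ
open import Data.Nat.Base as ℕ using (ℕ; zero; suc)
open import Data.Nat.Induction using (<-rec)
import Data.Nat.Properties as ℕ
open import Data.Product.Base using (∃; _×_; _,_; proj₁; proj₂)
open import Data.Rational.Base as ℚ using (ℚ; mkℚ; 0ℚ; 1ℚ)
import Data.Rational.Properties as ℚ
open import Data.Rational.Unnormalised.Base as ℚᵘ using (mkℚᵘ; *≡*; *≤*)
import Data.Rational.Unnormalised.Properties as ℚᵘ
open import Data.Sum.Base using (_⊎_; inj₁; inj₂; [_,_]′)
open import Data.Unit.Polymorphic.Base using (tt) renaming (⊤ to Unit)
open import Function.Base using (_∘_; id)
open import Function.Bundles using (Func; Injection; Inverse; _⟨$⟩_)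
open import Level using (Level; _⊔_)
open import Relation.Binary.Bundles using (Setoid)
open import Relation.Binary.Core using (Rel)
open import Relation.Binary.Definitions using (Reflexive; Symmetric; tri<; tri≈; tri>)
import Relation.Binary.Lattice.Bundles as OrderTheoretic
open import Relation.Binary.PropositionalEquality as ≡ using (_≡_; _≢_; refl; subst)
import Relation.Binary.Reasoning.Setoid as SetoidReasoning
open import Relation.Nullary.Decidable.Core using (Dec; yes; no; isYes; toWitness; fromWitness; decidable-stable)
open import Relation.Nullary.Negation using (¬_; contradiction)
open import Relation.Unary using (Pred)

open ℝ using (cut)

private variable
  α ρ ι ξ υ ℓ₁ ℓ₂ : Level

-- Cantor-Bernstein for setoids

module CantorBernstein (em : ∀ {ℓ} → ExcludedMiddle ℓ)
  {X : Setoid ξ ℓ₁} {Y : Setoid υ ℓ₂} (f : Injection X Y) (g : Injection Y X) where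

  private
    module X = Setoid X
    module Y = Setoid Y
    module f = Injection f
    module g = Injection g

  -- Iterating g ∘ f on the part of X that g misses; the bijection is f there
  -- and the inverse of g elsewhere.
  data Core : X.Carrier → Set (ξ ⊔ υ ⊔ ℓ₁) where
    start : ∀ {x} → (∀ y → ¬ (g.to y X.≈ x)) → Core x
    step  : ∀ {x x′} → Core x → g.to (f.to x) X.≈ x′ → Core x′

  Core-resp : ∀ {x x′} → x X.≈ x′ → Core x → Core x′
  Core-resp x≈x′ (start missed) = start λ y gy≈x′ → missed y (X.trans gy≈x′ (X.sym x≈x′))
  Core-resp x≈x′ (step c gfw≈x) = step c (X.trans gfw≈x x≈x′)

  -- A relation rather than a function: once it is total, surjective, functional and injective up to
  -- setoid equality, both directions and their laws follow at once.
  Graph : X.Carrier → Y.Carrier → Set _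
  Graph x y = Core x × f.to x Y.≈ y ⊎ ¬ Core x × g.to y X.≈ x

  total : ∀ x → ∃ (Graph x)
  total x with em {P = Core x} | em {P = ∃ λ y → g.to y X.≈ x}
  ... | yes c | _              = f.to x , inj₁ (c , Y.refl)
  ... | no ¬c | yes (y , gy≈x) = y , inj₂ (¬c , gy≈x)
  ... | no ¬c | no missed      = contradiction (start λ y gy≈x → missed (y , gy≈x)) ¬c

  surjective : ∀ y → ∃ λ x → Graph x y
  surjective y with em {P = Core (g.to y)}
  ... | yes (start missed)      = contradiction X.refl (missed y)
  ... | yes (step {x} c gfx≈gy) = x , inj₁ (c , g.injective gfx≈gy)
  ... | no ¬c                   = g.to y , inj₂ (¬c , X.refl)

  functional : ∀ {x x′ y y′} → Graph x y → Graph x′ y′ → x X.≈ x′ → y Y.≈ y′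
  functional (inj₁ (c , fx≈y)) (inj₁ (c′ , fx′≈y′)) x≈x′ =
    Y.trans (Y.sym fx≈y) (Y.trans (f.cong x≈x′) fx′≈y′)
  functional (inj₁ (c , _)) (inj₂ (¬c′ , _)) x≈x′ = contradiction (Core-resp x≈x′ c) ¬c′
  functional (inj₂ (¬c , _)) (inj₁ (c′ , _)) x≈x′ = contradiction (Core-resp (X.sym x≈x′) c′) ¬c
  functional (inj₂ (_ , gy≈x)) (inj₂ (_ , gy′≈x′)) x≈x′ =
    g.injective (X.trans gy≈x (X.trans x≈x′ (X.sym gy′≈x′)))

  injective : ∀ {x x′ y y′} → Graph x y → Graph x′ y′ → y Y.≈ y′ → x X.≈ x′
  injective (inj₁ (_ , fx≈y)) (inj₁ (_ , fx′≈y′)) y≈y′ =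
    f.injective (Y.trans fx≈y (Y.trans y≈y′ (Y.sym fx′≈y′)))
  -- Here `x′` is `g (f x)`, so it would lie in the core together with `x`.
  injective (inj₁ (c , fx≈y)) (inj₂ (¬c′ , gy′≈x′)) y≈y′ =
    contradiction (step c (X.trans (g.cong (Y.trans fx≈y y≈y′)) gy′≈x′)) ¬c′
  injective (inj₂ (¬c , gy≈x)) (inj₁ (c′ , fx′≈y′)) y≈y′ =
    contradiction (step c′ (X.trans (g.cong (Y.trans fx′≈y′ (Y.sym y≈y′))) gy≈x)) ¬c
  injective (inj₂ (_ , gy≈x)) (inj₂ (_ , gy′≈x′)) y≈y′ =
    X.trans (X.sym gy≈x) (X.trans (g.cong y≈y′) gy′≈x′)

  inverse : Inverse X Y
  inverse = record
    { to        = proj₁ ∘ total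
    ; from      = proj₁ ∘ surjective
    ; to-cong   = functional (proj₂ (total _)) (proj₂ (total _))
    ; from-cong = injective (proj₂ (surjective _)) (proj₂ (surjective _))
    ; inverse   = functional (proj₂ (total _)) (proj₂ (surjective _))
                , injective (proj₂ (surjective _)) (proj₂ (total _))
    }

-- Maximal cliques by Zermelo's towers, and least cardinals

module Classical
  (em : ∀ {ℓ} → ExcludedMiddle ℓ)
  (ac : ∀ {a ℓ₁ b ℓ₂ r} → AxiomOfChoice a ℓ₁ b ℓ₂ r) where

  -- Excluded middle makes decidable subsets an impredicative power set,
  -- which the definition of Tower below relies on.
  Subset : Set α → Set α
  Subset A = A → Bool

  infix 4 _∈_ _⊆_

  _∈_ : {A : Set α} → A → Subset A → Set
  x ∈ S = T (S x)

  _⊆_ : {A : Set α} → Subset A → Subset A → Set α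
  S ⊆ S′ = ∀ x → x ∈ S → x ∈ S′

  ⟦_⟧ : {A : Set α} → Pred A ρ → Subset A
  ⟦ P ⟧ x = isYes (em {P = P x})

  to∈ : {A : Set α} (P : Pred A ρ) {x : A} → P x → x ∈ ⟦ P ⟧
  to∈ P = fromWitness

  from∈ : {A : Set α} (P : Pred A ρ) {x : A} → x ∈ ⟦ P ⟧ → P x
  from∈ P = toWitness

  module MaximalClique {A : Set α} {r} (R : Rel A r)
    (R-refl : Reflexive R) (R-sym : Symmetric R) where

    Clique : Subset A → Set _
    Clique S = ∀ x y → x ∈ S → y ∈ S → R x y

    Extends : Subset A → A → Set _
    Extends S x = ¬ (x ∈ S) × (∀ y → y ∈ S → R x y)

    Extendable : Subset A → Set _
    Extendable S = ∃ (Extends S)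

    extendables : Setoid _ _
    extendables = record
      { Carrier       = ∃ Extendable
      ; _≈_           = λ (S , _) (S′ , _) → S ⊆ S′ × S′ ⊆ S
      ; isEquivalence = record
        { refl  = (λ _ → id) , λ _ → id
        ; sym   = λ (S⊆S′ , S′⊆S) → S′⊆S , S⊆S′
        ; trans = λ (S⊆S′ , S′⊆S) (S′⊆S″ , S″⊆S′) →
            (λ x → S′⊆S″ x ∘ S⊆S′ x) , λ x → S′⊆S x ∘ S″⊆S′ x
        }
      }

    -- The axiom of choice is needed only to make the picked element depend on
    -- nothing but the members of S.
    choice : ∃ λ (f : Func extendables (≡.setoid A)) → ∀ S → Extends (proj₁ S) (f ⟨$⟩ S)
    choice = ac extendables (≡.setoid A) (Extends ∘ proj₁)
      (λ { (S⊆S′ , S′⊆S) refl (x∉S , compatible) →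
           x∉S ∘ S′⊆S _ , λ y → compatible y ∘ S′⊆S y })
      proj₂

    pick : ∃ Extendable → A
    pick S = proj₁ choice ⟨$⟩ S

    pick-extends : ∀ {S} (e : Extendable S) → Extends S (pick (S , e))
    pick-extends e = proj₂ choice (_ , e)

    pick-cong : ∀ {S S′} {e : Extendable S} {e′ : Extendable S′} →
                S ⊆ S′ → S′ ⊆ S → pick (S , e) ≡ pick (S′ , e′)
    pick-cong S⊆S′ S′⊆S = Func.cong (proj₁ choice) (S⊆S′ , S′⊆S)

    -- Empty when `S` cannot be extended and a single point otherwise, so `next` needs no case
    -- distinction.
    Picked : Subset A → Pred A _
    Picked S x = ∃ λ (e : Extendable S) → x ≡ pick (S , e)

    Picked-unique : ∀ S {x y} → Picked S x → Picked S y → x ≡ y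
    Picked-unique S (e , x≡) (e′ , y≡) =
      ≡.trans x≡ (≡.trans (pick-cong {S} (λ _ → id) (λ _ → id)) (≡.sym y≡))

    next : Subset A → Subset A
    next S = ⟦ (λ x → x ∈ S ⊎ Picked S x) ⟧

    from-next : ∀ S {x} → x ∈ next S → x ∈ S ⊎ Picked S x
    from-next S = from∈ λ x → x ∈ S ⊎ Picked S x

    to-next : ∀ S {x} → x ∈ S ⊎ Picked S x → x ∈ next S
    to-next S = to∈ λ x → x ∈ S ⊎ Picked S x

    next-cong : ∀ {S S′} → S ⊆ S′ → S′ ⊆ S → next S ⊆ next S′
    next-cong {S} {S′} S⊆S′ S′⊆S x x∈ with from-next S x∈
    ... | inj₁ x∈S = to-next S′ (inj₁ (S⊆S′ x x∈S))
    ... | inj₂ ((w , w∉S , compatible) , x≡) =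
      to-next S′ (inj₂ (e , ≡.trans x≡ (pick-cong {S} {S′} S⊆S′ S′⊆S)))
      where
      e : Extendable S′
      e = w , w∉S ∘ S′⊆S w , λ y → compatible y ∘ S′⊆S y

    Covered : Subset (Subset A) → Pred A _
    Covered G x = ∃ λ S → S ∈ G × x ∈ S

    ⋃ : Subset (Subset A) → Subset A
    ⋃ G = ⟦ Covered G ⟧

    -- Zermelo's substitute for transfinite iteration of `next`: closure under unions replaces limit
    -- stages, and induction on the derivation replaces ordinals.
    data Tower : Subset A → Set α where
      grow  : ∀ {S} → Tower S → Tower (next S)
      union : ∀ G → (∀ S → S ∈ G → Tower S) → Tower (⋃ G)

    ⊆⋃ : ∀ G {S} → S ∈ G → S ⊆ ⋃ G
    ⊆⋃ G S∈G x x∈S = to∈ (Covered G) (_ , S∈G , x∈S)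

    ⋃⊆ : ∀ G {S} → (∀ S′ → S′ ∈ G → S′ ⊆ S) → ⋃ G ⊆ S
    ⋃⊆ G bound x x∈ = let S′ , S′∈G , x∈S′ = from∈ (Covered G) x∈ in bound S′ S′∈G x x∈S′

    -- `next S` has at most one point more than `S`, so a set between the two equals one of them.
    gap : ∀ {C} → (∀ {S} → Tower S → S ⊆ C ⊎ C ⊆ S) →
          ∀ {S} → Tower S → S ⊆ C ⊎ next C ⊆ S
    gap {C} comparable (grow {S} t) with gap comparable t
    ... | inj₂ C⁺⊆S = inj₂ λ x → to-next S ∘ inj₁ ∘ C⁺⊆S x
    ... | inj₁ S⊆C with comparable (grow t) | em {P = C ⊆ S}
    ...   | inj₁ S⁺⊆C | _       = inj₁ S⁺⊆C
    ...   | inj₂ _    | yes C⊆S = inj₂ (next-cong C⊆S S⊆C)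
    ...   | inj₂ C⊆S⁺ | no C⊈S  = inj₁ S⁺⊆C
      where
      S⁺⊆C : next S ⊆ C
      S⁺⊆C x x∈S⁺ with from-next S x∈S⁺
      ... | inj₁ x∈S    = S⊆C x x∈S
      -- Since `x` is the only new point of `next S`, a `C` without `x` would be contained in `S`.
      ... | inj₂ picked = decidable-stable em λ x∉C → C⊈S λ w w∈C →
        [ id
        , (λ picked′ → contradiction
             (subst (_∈ C) (Picked-unique S picked′ picked) w∈C) x∉C)
        ]′ (from-next S (C⊆S⁺ w w∈C))
    gap {C} comparable (union G ts) with em {P = ∃ λ S → S ∈ G × next C ⊆ S}
    ... | yes (S , S∈G , C⁺⊆S) = inj₂ λ x → ⊆⋃ G S∈G x ∘ C⁺⊆S x
    ... | no none = inj₁ (⋃⊆ G λ S S∈G →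
      [ id , (λ C⁺⊆S → contradiction (S , S∈G , C⁺⊆S) none) ]′ (gap comparable (ts S S∈G)))

    comparable : ∀ {C} → Tower C → ∀ {S} → Tower S → S ⊆ C ⊎ C ⊆ S
    comparable (grow {C} t) s with gap (comparable t) s
    ... | inj₁ S⊆C  = inj₁ λ x → to-next C ∘ inj₁ ∘ S⊆C x
    ... | inj₂ C⁺⊆S = inj₂ C⁺⊆S
    comparable (union G ts) {S} s with em {P = ∃ λ C → C ∈ G × S ⊆ C}
    ... | yes (C , C∈G , S⊆C) = inj₁ λ x → ⊆⋃ G C∈G x ∘ S⊆C x
    ... | no none = inj₂ (⋃⊆ G λ C C∈G →
      [ (λ S⊆C → contradiction (C , C∈G , S⊆C) none) , id ]′ (comparable (ts C C∈G) s))

    -- Towers form a chain, so two points of a union already lie in a common member.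
    tower-clique : ∀ {S} → Tower S → Clique S
    tower-clique (grow {S} t) x y x∈ y∈ with from-next S x∈ | from-next S y∈
    ... | inj₁ x∈S        | inj₁ y∈S        = tower-clique t x y x∈S y∈S
    ... | inj₁ x∈S        | inj₂ (e , refl) = R-sym (proj₂ (pick-extends e) x x∈S)
    ... | inj₂ (e , refl) | inj₁ y∈S        = proj₂ (pick-extends e) y y∈S
    ... | inj₂ picked     | inj₂ picked′    = subst (R x) (Picked-unique S picked picked′) R-refl
    tower-clique (union G ts) x y x∈ y∈
      with S , S∈G , x∈S ← from∈ (Covered G) x∈ | S′ , S′∈G , y∈S′ ← from∈ (Covered G) y∈
      with comparable (ts S S∈G) (ts S′ S′∈G)
    ... | inj₁ S′⊆S = tower-clique (ts S S∈G) x y x∈S (S′⊆S y y∈S′)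
    ... | inj₂ S⊆S′ = tower-clique (ts S′ S′∈G) x y (S⊆S′ x x∈S) y∈S′

    maximal-clique : ∃ λ S → Clique S × (∀ x → (∀ y → y ∈ S → R x y) → x ∈ S)
    maximal-clique = M , tower-clique M-tower , maximal
      where
      M : Subset A
      M = ⋃ ⟦ Tower ⟧

      M-tower : Tower M
      M-tower = union ⟦ Tower ⟧ λ _ → from∈ Tower

      maximal : ∀ x → (∀ y → y ∈ M → R x y) → x ∈ M
      -- `M` contains every tower, among them `next M`, so the point picked outside `M` would lie in
      -- `M`.
      maximal x compatible = decidable-stable em λ x∉M →
        let e = x , x∉M , compatible
        in proj₁ (pick-extends e)
             (⊆⋃ ⟦ Tower ⟧ (to∈ Tower (grow M-tower)) _ (to-next M (inj₂ (e , refl))))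

  -- Hönig's argument: take a maximal set of points of the product on which all
  -- projections are injective.  If every projection missed a point, the missed
  -- points would together give an element of the product that could be added.
  least-cardinal : {I : Set ι} (X : I → Setoid ξ ℓ₁) → I →
                   ∃ λ i → ∀ j → Injection (X i) (X j)
  least-cardinal {I = I} X i₀ = conclude em
    where
    module X i = Setoid (X i)

    R : Rel (∀ i → X.Carrier i) _
    R s t = ∀ i j → X._≈_ i (s i) (t i) → X._≈_ j (s j) (t j)

    open MaximalClique R (λ _ j _ → X.refl j) (λ Rst i j → X.sym j ∘ Rst i j ∘ X.sym i)

    S = proj₁ maximal-clique

    Missed : ∀ i → X.Carrier i → Set _
    Missed i x = ∀ s → s ∈ S → ¬ X._≈_ i (s i) x

    conclude : Dec (∀ i → ∃ (Missed i)) → ∃ λ i → ∀ j → Injection (X i) (X j)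
    conclude (yes missed) = contradiction (X.refl i₀) (proj₂ (missed i₀) s s∈S)
      where
      s : ∀ i → X.Carrier i
      s = proj₁ ∘ missed

      s∈S : s ∈ S
      -- No `t` in `S` agrees with `s` in any coordinate, so the required implications hold
      -- vacuously.
      s∈S = proj₂ (proj₂ maximal-clique) s λ t t∈S i j si≈ti →
        contradiction (X.sym i si≈ti) (proj₂ (missed i) t t∈S)
    -- Some projection maps `S` onto its factor `X i`; points of `X i` lift to `S`, and the other
    -- coordinates of the lifts give the injections.
    conclude (no ¬missed) = i , λ j → record
      { to        = λ x → proj₁ (lift x) j
      ; cong      = λ {x} {y} x≈y → clique (lift x) (lift y) i j
          (X.trans i (over (lift x)) (X.trans i x≈y (X.sym i (over (lift y)))))
      ; injective = λ {x} {y} tx≈ty →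
          X.trans i (X.sym i (over (lift x)))
            (X.trans i (clique (lift x) (lift y) j i tx≈ty) (over (lift y)))
      }
      where
      surjective-projection : ∃ λ i → ¬ ∃ (Missed i)
      surjective-projection = decidable-stable em λ none →
        ¬missed λ i → decidable-stable em λ ¬missed-i → none (i , ¬missed-i)

      i = proj₁ surjective-projection

      Lift : X.Carrier i → Set _
      Lift x = ∃ λ s → s ∈ S × X._≈_ i (s i) x

      lift : ∀ x → Lift x
      lift x = decidable-stable em λ none →
        proj₂ surjective-projection (x , λ s s∈S si≈x → none (s , s∈S , si≈x))

      over : ∀ {x} (l : Lift x) → X._≈_ i (proj₁ l i) x
      over (_ , _ , si≈x) = si≈x

      clique : ∀ {x y} (l : Lift x) (l′ : Lift y) → R (proj₁ l) (proj₁ l′)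
      clique (s , s∈S , _) (t , t∈S , _) = proj₁ (proj₂ maximal-clique) s t s∈S t∈S

-- Arithmetic of unit fractions

sameDenominator-+ : ∀ i j k → mkℚᵘ (i ℤ.+ j) k ℚᵘ.≃ mkℚᵘ i k ℚᵘ.+ mkℚᵘ j k
sameDenominator-+ i j k = *≡* (≡.trans (≡.sym (ℤ.*-assoc (i ℤ.+ j) D D))
  (≡.cong (ℤ._* D) (ℤ.*-distribʳ-+ D i j)))
  where
  D = ℤ.+ suc k

fromℚᵘ-homo-+ : ∀ p q → ℚ.fromℚᵘ (p ℚᵘ.+ q) ≡ ℚ.fromℚᵘ p ℚ.+ ℚ.fromℚᵘ q
fromℚᵘ-homo-+ p q = ℚ.toℚᵘ-injective (begin
  ℚ.toℚᵘ (ℚ.fromℚᵘ (p ℚᵘ.+ q))                   ≈⟨ ℚ.toℚᵘ-fromℚᵘ (p ℚᵘ.+ q) ⟩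
  p ℚᵘ.+ q                                       ≈⟨ ℚᵘ.+-cong (ℚ.toℚᵘ-fromℚᵘ p) (ℚ.toℚᵘ-fromℚᵘ q) ⟨
  ℚ.toℚᵘ (ℚ.fromℚᵘ p) ℚᵘ.+ ℚ.toℚᵘ (ℚ.fromℚᵘ q)   ≈⟨ ℚ.toℚᵘ-homo-+ (ℚ.fromℚᵘ p) (ℚ.fromℚᵘ q) ⟨
  ℚ.toℚᵘ (ℚ.fromℚᵘ p ℚ.+ ℚ.fromℚᵘ q)             ∎)
  where open SetoidReasoning ℚᵘ.≃-setoid

infixl 7 _/suc_

abstract
  -- The fraction n/(k+1): the stored denominator is lowered by one.
  _/suc_ : ℕ → ℕ → ℚ
  n /suc k = ℚ.fromℚᵘ (mkℚᵘ (ℤ.+ n) k)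

unitFraction : ℕ → ℚ
unitFraction k = 1 /suc k

abstract
  unitFraction-antitone : ∀ {k l} → k ℕ.≤ l → unitFraction l ℚ.≤ unitFraction k
  unitFraction-antitone {k} {l} k≤l = ℚ.toℚᵘ-cancel-≤ (begin
    ℚ.toℚᵘ (unitFraction l)  ≃⟨ ℚ.toℚᵘ-fromℚᵘ (mkℚᵘ (ℤ.+ 1) l) ⟩
    mkℚᵘ (ℤ.+ 1) l           ≤⟨ *≤* (ℤ.*-monoˡ-≤-nonNeg (ℤ.+ 1) (ℤ.+≤+ (ℕ.s≤s k≤l))) ⟩
    mkℚᵘ (ℤ.+ 1) k           ≃⟨ ℚ.toℚᵘ-fromℚᵘ (mkℚᵘ (ℤ.+ 1) k) ⟨
    ℚ.toℚᵘ (unitFraction k)  ∎)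
    where open ℚᵘ.≤-Reasoning

  unitFraction-archimedean : ∀ {q} → 0ℚ ℚ.< q → ∃ λ k → unitFraction k ℚ.≤ q
  unitFraction-archimedean {mkℚ (ℤ.+ zero) d _} (ℚ.*<* (ℤ.+<+ ()))
  unitFraction-archimedean {mkℚ (ℤ.-[1+ n ]) d _} (ℚ.*<* ())
  -- Here q is (n+1)/(d+1), so its own denominator serves.
  unitFraction-archimedean {q@(mkℚ (ℤ.+ (suc n)) d _)} _ = d , ℚ.toℚᵘ-cancel-≤ (begin
    ℚ.toℚᵘ (unitFraction d)  ≃⟨ ℚ.toℚᵘ-fromℚᵘ (mkℚᵘ (ℤ.+ 1) d) ⟩
    mkℚᵘ (ℤ.+ 1) d           ≤⟨ *≤* (ℤ.*-monoʳ-≤-nonNeg (ℤ.+ suc d) (ℤ.+≤+ (ℕ.s≤s (ℕ.z≤n {n})))) ⟩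
    ℚ.toℚᵘ q                 ∎)
    where open ℚᵘ.≤-Reasoning

  /suc-step : ∀ n k → (suc n) /suc k ≡ unitFraction k ℚ.+ n /suc k
  /suc-step n k = ≡.trans
    (ℚ.fromℚᵘ-cong {mkℚᵘ (ℤ.+ suc n) k} {mkℚᵘ (ℤ.+ 1) k ℚᵘ.+ mkℚᵘ (ℤ.+ n) k}
      (sameDenominator-+ (ℤ.+ 1) (ℤ.+ n) k))
    (fromℚᵘ-homo-+ (mkℚᵘ (ℤ.+ 1) k) (mkℚᵘ (ℤ.+ n) k))

  suc-/suc : ∀ k → suc k /suc k ≡ 1ℚ
  suc-/suc k = ℚ.fromℚᵘ-cong {mkℚᵘ (ℤ.+ suc k) k} {mkℚᵘ (ℤ.+ 1) 0} (*≡* (ℤ.*-comm (ℤ.+ suc k) (ℤ.+ 1)))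

-- Order and addition of cuts

cut-down-≤ : ∀ x {p q} → p ℚ.≤ q → cut x q → cut x p
cut-down-≤ x {p} {q} p≤q q∈x with ℚ.<-cmp p q
... | tri< p<q _ _  = ℝ.down x p<q q∈x
... | tri≈ _ refl _ = q∈x
... | tri> _ _ q<p  = contradiction (ℚ.<-≤-trans q<p p≤q) (ℚ.<-irrefl refl)

[p-q]+q≡p : ∀ p q → (p ℚ.- q) ℚ.+ q ≡ p
[p-q]+q≡p p q = ≡.trans (ℚ.+-assoc p (ℚ.- q) q)
  (≡.trans (≡.cong (p ℚ.+_) (ℚ.+-inverseˡ q)) (ℚ.+-identityʳ p))

x≤x+y : ∀ x {y} → 0ᵣ ≤ᵣ y → x ≤ᵣ x +ᵣ y
x≤x+y x 0≤y q q∈x =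
  -- Moving up to some `p` in the cut leaves a negative `q - p`, which belongs to every nonnegative
  -- `y`.
  let p , q<p , p∈x = ℝ.rounded x q∈x
      q-p<0 = subst (q ℚ.- p ℚ.<_) (ℚ.+-inverseʳ p) (ℚ.+-monoˡ-< (ℚ.- p) q<p)
  in p , q ℚ.- p , p∈x , 0≤y (q ℚ.- p) q-p<0
   , ≡.sym (≡.trans (ℚ.+-comm p (q ℚ.- p)) ([p-q]+q≡p q p))

≤-<ᵣ-trans : ∀ x y z → x ≤ᵣ y → y <ᵣ z → x <ᵣ z
≤-<ᵣ-trans x y z x≤y (y≤z , z≰y) = (λ q → y≤z q ∘ x≤y q) , λ z≤x → z≰y λ q → x≤y q ∘ z≤x q

module _ (em : ∀ {ℓ} → ExcludedMiddle ℓ) where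

  least : ∀ {p} (P : Pred ℕ p) {n} → P n → ∃ λ m → P m × (∀ k → P k → m ℕ.≤ k)
  least P {n} = <-rec (λ n → P n → ∃ λ m → P m × (∀ k → P k → m ℕ.≤ k)) search n
    where
    search : ∀ n → (∀ {m} → m ℕ.< n → P m → _) → P n → _
    search n rec Pn with em {P = ∃ λ m → m ℕ.< n × P m}
    ... | yes (m , m<n , Pm) = rec m<n Pm
    ... | no none = n , Pn , λ k Pk → ℕ.≮⇒≥ λ k<n → none (k , k<n , Pk)

  positive⇒cut : ∀ x → 0ᵣ <ᵣ x → ∃ λ q → 0ℚ ℚ.< q × cut x q
  positive⇒cut x (_ , x≰0) =
    let q , q∈x , q≮0 = nonnegative
        p , q<p , p∈x = ℝ.rounded x q∈x
    in p , ℚ.≤-<-trans (ℚ.≮⇒≥ q≮0) q<p , p∈x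
    where
    nonnegative : ∃ λ q → cut x q × ¬ (q ℚ.< 0ℚ)
    nonnegative = decidable-stable em λ none →
      x≰0 λ q q∈x → decidable-stable em λ q≮0 → none (q , q∈x , q≮0)

  module _ (ac : ∀ {a ℓ₁ b ℓ₂ r} → AxiomOfChoice a ℓ₁ b ℓ₂ r)
    {c ℓ} (𝔅 : BooleanAlgebra c ℓ) (m : Measure 𝔅) where

    open BooleanAlgebra 𝔅 renaming (¬_ to ∁_; refl to ≈-refl; sym to ≈-sym; trans to ≈-trans)
    open BooleanAlgebraProperties 𝔅 hiding (poset; ⊤≉⊥)
    open OrderTheoretic.Lattice ∨-∧-orderTheoreticLattice
      using (x∧y≤x; x∧y≤y; ∧-greatest; antisym)
      renaming (refl to ≤-refl; trans to ≤-trans; reflexive to ≤-reflexive)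
    open Order 𝔅
    open Measure m
    open Relative 𝔅
    open Classical em ac using (least-cardinal)
    private module Rel b = Order (relative b)

    -- Disjointness and differences

    ⊥≤x : ∀ x → ⊥ ≤ x
    ⊥≤x x = ≈-sym (∧-zeroˡ x)

    x≤⊤ : ∀ x → x ≤ ⊤
    x≤⊤ x = ≈-sym (∧-identityʳ x)

    ≤⊥⇒≈⊥ : ∀ {x} → x ≤ ⊥ → x ≈ ⊥
    ≤⊥⇒≈⊥ x≤⊥ = antisym x≤⊥ (⊥≤x _)

    ≉⊥-mono : ∀ {x y} → x ≤ y → x ≉ ⊥ → y ≉ ⊥
    ≉⊥-mono x≤y x≉⊥ y≈⊥ = x≉⊥ (≤⊥⇒≈⊥ (≤-trans x≤y (≤-reflexive y≈⊥)))

    disjoint-mono : ∀ {x y x′ y′} → x ≤ x′ → y ≤ y′ → x′ ∧ y′ ≈ ⊥ → x ∧ y ≈ ⊥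
    disjoint-mono x≤x′ y≤y′ x′∧y′≈⊥ = ≤⊥⇒≈⊥ (≤-trans
      (∧-greatest (≤-trans (x∧y≤x _ _) x≤x′) (≤-trans (x∧y≤y _ _) y≤y′))
      (≤-reflexive x′∧y′≈⊥))

    disjoint-sym : ∀ {x y} → x ∧ y ≈ ⊥ → y ∧ x ≈ ⊥
    disjoint-sym = ≈-trans (∧-comm _ _)

    disjoint⇒≤∁ : ∀ {x y} → x ∧ y ≈ ⊥ → x ≤ ∁ y
    disjoint⇒≤∁ {x} {y} x∧y≈⊥ = begin
      x                    ≈⟨ ∧-identityʳ x ⟨
      x ∧ ⊤                ≈⟨ ∧-congˡ (∨-complementʳ y) ⟨
      x ∧ (y ∨ ∁ y)        ≈⟨ ∧-distribˡ-∨ x y (∁ y) ⟩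
      (x ∧ y) ∨ (x ∧ ∁ y)  ≈⟨ ∨-congʳ x∧y≈⊥ ⟩
      ⊥ ∨ (x ∧ ∁ y)        ≈⟨ ∨-identityˡ (x ∧ ∁ y) ⟩
      x ∧ ∁ y              ∎
      where open SetoidReasoning setoid

    ∖≈⊥⇒≤ : ∀ {x y} → x ∖ y ≈ ⊥ → x ≤ y
    ∖≈⊥⇒≤ x∖y≈⊥ = ≤-trans (disjoint⇒≤∁ x∖y≈⊥) (≤-reflexive (¬-involutive _))

    ∖-monoˡ : ∀ {x y} z → x ≤ y → x ∖ z ≤ y ∖ z
    ∖-monoˡ z x≤y = ∧-greatest (≤-trans (x∧y≤x _ _) x≤y) (x∧y≤y _ _)

    -- Additivity and monotonicity of the measure

    μ-split : ∀ {x y} → x ≤ y → μ y ≃ᵣ μ x +ᵣ μ (y ∖ x)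
    μ-split {x} {y} x≤y =
      -- The complement laws of the algebra below `y` split `y` into `x` and a disjoint rest.
      let module 𝔅y = BooleanAlgebra (relative y)
          μy≤ , ≤μy = μ-cong (𝔅y.∨-complementʳ (x , x≤y))
          add≤ , ≤add = additive x (y ∖ x) (𝔅y.∧-complementʳ (x , x≤y))
      in (λ q → add≤ q ∘ ≤μy q) , λ q → μy≤ q ∘ ≤add q

    μ-mono : ∀ {x y} → x ≤ y → μ x ≤ᵣ μ y
    μ-mono {x} {y} x≤y q = proj₂ (μ-split x≤y) q ∘ x≤x+y (μ x) {μ (y ∖ x)} (nonneg (y ∖ x)) q

    -- A positive `p` in the cut of `μ ⊥` would put 1 = (1 - p) + p in the cut of `μ ⊤`, that is,
    -- strictly below 1.
    μ⊥≤0 : μ ⊥ ≤ᵣ 0ᵣ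
    μ⊥≤0 q q∈ = decidable-stable em λ q≮0 →
      let p , q<p , p∈ = ℝ.rounded (μ ⊥) q∈
          0<p = ℚ.≤-<-trans (ℚ.≮⇒≥ q≮0) q<p
          1-p<1 = subst (1ℚ ℚ.- p ℚ.<_) (ℚ.+-identityʳ 1ℚ) (ℚ.+-monoʳ-< 1ℚ (ℚ.neg-antimono-< 0<p))
      in ℚ.<-irrefl refl (proj₁ normalized 1ℚ (proj₁ (μ-cong (∨-identityʳ ⊤)) 1ℚ
           (proj₂ (additive ⊤ ⊥ (∧-zeroʳ ⊤)) 1ℚ
             (1ℚ ℚ.- p , p , proj₂ normalized _ 1-p<1 , p∈ , ≡.sym ([p-q]+q≡p 1ℚ p)))))

    ⊤≉⊥ : ⊤ ≉ ⊥
    ⊤≉⊥ ⊤≈⊥ = ℚ.<-irrefl refl (μ⊥≤0 0ℚ (proj₁ (μ-cong ⊤≈⊥) 0ℚ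
      (proj₂ normalized 0ℚ (ℚ.positive⁻¹ 1ℚ))))

    -- Homogeneous elements

    Homogeneous : Pred Carrier _
    Homogeneous a = ∃ λ κ → ∀ b → b ≉ ⊥ → b ≤ a → IsUr (m ∣ b) κ

    Homogeneous-≤ : ∀ {a b} → b ≤ a → Homogeneous a → Homogeneous b
    Homogeneous-≤ b≤a (κ , ur) = κ , λ d d≉⊥ d≤b → ur d d≉⊥ (≤-trans d≤b b≤a)

    Homogeneous⇒SameUr : ∀ {a b} → a ≉ ⊥ → b ≉ ⊥ → b ≤ a → Homogeneous a → SameUr m b a
    Homogeneous⇒SameUr a≉⊥ b≉⊥ b≤a (κ , ur) = κ , ur _ b≉⊥ b≤a , ur _ a≉⊥ ≤-refl

    -- Ensures that the minimisation over dense families has something to range over.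
    everything-dense : ∀ b → UniformlyDense (m ∣ b) (λ _ → Unit)
    everything-dense b (x , x≤b) ε 0<ε = (x , x≤b) , tt , ≤-refl , ≤-<ᵣ-trans (μ (x ∧ (b ∖ x))) 0ᵣ ε
      (λ q → μ⊥≤0 q ∘ proj₁ (μ-cong (BooleanAlgebra.∧-complementʳ (relative b) (x , x≤b))) q) 0<ε

    below : ∀ {b′ b} → Pred (∃ (_≤ b)) (c ⊔ ℓ) → Pred (∃ (_≤ b′)) (c ⊔ ℓ)
    below {b = b} F (x , _) = ∃ λ (x≤b : x ≤ b) → F (x , x≤b)

    -- An approximant of `x` lies below `x`, hence below `b′`, and its difference from `x` does not
    -- depend on the ambient algebra.
    below-dense : ∀ {b b′} → b′ ≤ b → ∀ F → UniformlyDense (m ∣ b) F → UniformlyDense (m ∣ b′) (below F)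
    below-dense {b} {b′} b′≤b F dense (x , x≤b′) ε 0<ε =
      let x≤b = ≤-trans x≤b′ b′≤b
          (f , f≤b) , f∈F , f≤x , small = dense (x , x≤b) ε 0<ε
      in (f , ≤-trans f≤x x≤b′) , (f≤b , f∈F) , f≤x
       , ≤-<ᵣ-trans (μ (x ∧ (b′ ∖ f))) (μ (x ∧ (b ∖ f))) ε
           (proj₁ (μ-cong (≈-trans (≈-sym (absorb f x≤b′)) (absorb f x≤b)))) small
      where
      absorb : ∀ {x b} f → x ≤ b → x ∖ f ≈ x ∧ (b ∖ f)
      absorb {x} {b} f x≤b = ≈-trans (∧-congʳ x≤b) (∧-assoc x b (∁ f))

    below-injection : ∀ {b b′} F → Injection (Rel.⟪_⟫ b′ (below F)) (Rel.⟪_⟫ b F)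
    below-injection F = record
      { to        = λ ((x , _) , (x≤b , x∈F)) → (x , x≤b) , x∈F
      ; cong      = id
      ; injective = id
      }

    -- Minimising over pairs of an element and a dense family in it avoids presupposing that ur
    -- exists. Every dense family in a nonzero `b′ ≤ b` competes with the minimal `F`, and the trace
    -- of `F` on `b′` attains the minimum by Cantor-Bernstein.
    homogeneous-below : ∀ d → d ≉ ⊥ → ∃ λ b → b ≉ ⊥ × b ≤ d × Homogeneous b
    homogeneous-below d d≉⊥ =
      let (b , b≉⊥ , b≤d , F , F-dense) , inject =
            least-cardinal (λ (b , _ , _ , F , _) → Rel.⟪_⟫ b F) dense-in-d
      in b , b≉⊥ , b≤d , Rel.⟪_⟫ b F , λ b′ b′≉⊥ b′≤b →
           let b′≤d = ≤-trans b′≤b b≤d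
               F′-dense = below-dense b′≤b F F-dense
           in (below F , F′-dense , CantorBernstein.inverse em
                 (inject (b′ , b′≉⊥ , b′≤d , below F , F′-dense)) (below-injection F))
            , λ G G-dense → inject (b′ , b′≉⊥ , b′≤d , G , G-dense)
      where
      dense-in-d : ∃ λ b → b ≉ ⊥ × b ≤ d × ∃ (UniformlyDense (m ∣ b))
      dense-in-d = d , d≉⊥ , ≤-refl , (λ _ → Unit) , everything-dense d

    -- Greedy construction of the partition

    module _ (nonatomic : NonAtomic m) (positive : StrictlyPositive m) where

      -- Take a partition into pieces of measure at most some `q` strictly below `μ d`: a piece
      -- meeting `d` cannot contain it.
      splitting : ∀ d → d ≉ ⊥ → ∃ λ x → x ≉ ⊥ × x ≤ d × d ∖ x ≉ ⊥
      splitting d d≉⊥ =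
        let q , 0<q , q∈μd = positive⇒cut (μ d) (positive d d≉⊥)
            ε = fromℚ q
            0<ε = (λ p p<0 → ℚ.<-trans p<0 0<q) , λ ε≤0 → ℚ.<-irrefl refl (ε≤0 0ℚ 0<q)
            n , p , partition , small = nonatomic ε 0<ε
            i , d∧pi≉⊥ = meets p partition
        in d ∧ p i , d∧pi≉⊥ , x∧y≤x _ _ , λ d∖x≈⊥ →
             ℚ.<-irrefl refl (small i q (μ-mono (≤-trans (∖≈⊥⇒≤ d∖x≈⊥) (x∧y≤y _ _)) q q∈μd))
        where
        meets : ∀ {I : Set} (p : I → Carrier) → IsPartitionOfUnity p → ∃ λ i → d ∧ p i ≉ ⊥
        meets p partition = decidable-stable em λ none →
          let ⊤≤∁d = proj₂ (IsPartitionOfUnity.supremum partition) (∁ d) λ i →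
                disjoint⇒≤∁ (disjoint-sym (decidable-stable em λ d∧pi≉⊥ → none (i , d∧pi≉⊥)))
          in d≉⊥ (≈-trans (≤-trans (x≤⊤ d) ⊤≤∁d) (∧-complementʳ d))

      -- The third condition keeps every remainder nonzero, so the sequence never stops.
      Candidate : Carrier → Pred Carrier _
      Candidate r d = d ≉ ⊥ × d ≤ r × r ∖ d ≉ ⊥ × Homogeneous d

      candidate-mono : ∀ {r s d} → r ≤ s → Candidate r d → Candidate s d
      candidate-mono {d = d} r≤s (d≉⊥ , d≤r , r∖d≉⊥ , hom) =
        d≉⊥ , ≤-trans d≤r r≤s , ≉⊥-mono (∖-monoˡ d r≤s) r∖d≉⊥ , hom

      candidate : ∀ r → r ≉ ⊥ → ∃ (Candidate r)
      candidate r r≉⊥ =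
        let b , b≉⊥ , b≤r , hom = homogeneous-below r r≉⊥
            x , x≉⊥ , x≤b , b∖x≉⊥ = splitting b b≉⊥
        in x , candidate-mono b≤r (x≉⊥ , x≤b , b∖x≉⊥ , Homogeneous-≤ x≤b hom)

      unitFraction-cut : ∀ {x} → x ≉ ⊥ → ∃ λ k → cut (μ x) (unitFraction k)
      unitFraction-cut {x} x≉⊥ =
        let q , 0<q , q∈μx = positive⇒cut (μ x) (positive x x≉⊥)
            k , 1/k≤q = unitFraction-archimedean 0<q
        in k , cut-down-≤ (μ x) 1/k≤q q∈μx

      -- Stands in for maximal measure, which no candidate need attain; the best unit fraction is
      -- attained because its index is a least natural number.
      Large : Carrier → Pred Carrier _
      Large r a = ∀ d k → Candidate r d → cut (μ d) (unitFraction k) → cut (μ a) (unitFraction k)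

      abstract
        large-candidate : ∀ r → r ≉ ⊥ → ∃ λ a → Candidate r a × Large r a
        large-candidate r r≉⊥ =
          let d , d-candidate = candidate r r≉⊥
              k , 1/k∈μd = unitFraction-cut (proj₁ d-candidate)
              m , (a , a-candidate , 1/m∈μa) , minimal =
                least (λ k → ∃ λ d → Candidate r d × cut (μ d) (unitFraction k)) {k} (d , d-candidate , 1/k∈μd)
          in a , a-candidate , λ d l d-candidate 1/l∈μd →
               cut-down-≤ (μ a) (unitFraction-antitone (minimal l (d , d-candidate , 1/l∈μd))) 1/m∈μa

      remainder : ℕ → ∃ (_≉ ⊥)
      remainder zero    = ⊤ , ⊤≉⊥
      remainder (suc n) =
        let r , r≉⊥ = remainder n
            a , (_ , _ , r∖a≉⊥ , _) , _ = large-candidate r r≉⊥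
        in r ∖ a , r∖a≉⊥

      r : ℕ → Carrier
      r = proj₁ ∘ remainder

      chosen : ∀ n → ∃ λ a → Candidate (r n) a × Large (r n) a
      chosen n = large-candidate (r n) (proj₂ (remainder n))

      a : ℕ → Carrier
      a = proj₁ ∘ chosen

      a-candidate : ∀ n → Candidate (r n) (a n)
      a-candidate n = proj₁ (proj₂ (chosen n))

      a≤r : ∀ n → a n ≤ r n
      a≤r n = proj₁ (proj₂ (a-candidate n))

      r-antitone : ∀ {i j} → i ℕ.≤′ j → r j ≤ r i
      r-antitone (ℕ.≤′-reflexive refl) = ≤-refl
      r-antitone (ℕ.≤′-step i≤j)       = ≤-trans (x∧y≤x _ _) (r-antitone i≤j)

      a-disjoint-< : ∀ {i j} → i ℕ.< j → a i ∧ a j ≈ ⊥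
      a-disjoint-< {i} {j} i<j = disjoint-mono ≤-refl
        (≤-trans (a≤r j) (≤-trans (r-antitone (ℕ.≤⇒≤′ i<j)) (x∧y≤y (r i) (∁ a i))))
        (∧-complementʳ (a i))

      a-disjoint : ∀ i j → i ≢ j → a i ∧ a j ≈ ⊥
      a-disjoint i j i≢j with ℕ.<-cmp i j
      ... | tri< i<j _ _ = a-disjoint-< i<j
      ... | tri≈ _ i≡j _ = contradiction i≡j i≢j
      ... | tri> _ _ j<i = disjoint-sym (a-disjoint-< j<i)

      -- `r n` contains the `l + 1` disjoint pieces `a n`, ..., `a (n + l)`, each of measure above
      -- 1/(k+1).
      μ-r-large : ∀ {k} → (∀ n → cut (μ (a n)) (unitFraction k)) →
                  ∀ l n → cut (μ (r n)) (suc l /suc k)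
      μ-r-large 1/k∈μa zero n = μ-mono (a≤r n) _ (1/k∈μa n)
      μ-r-large {k} 1/k∈μa (suc l) n = subst (cut (μ (r n))) (≡.sym (/suc-step (suc l) k))
        (proj₂ (μ-split (a≤r n)) _ (_ , _ , 1/k∈μa n , μ-r-large 1/k∈μa l (suc n) , refl))

      -- With `l = k` and `r 0 = ⊤`, the fraction (k+1)/(k+1) = 1 would lie strictly below `μ ⊤`,
      -- which is 1.
      a-not-all-large : ∀ k → ¬ (∀ n → cut (μ (a n)) (unitFraction k))
      a-not-all-large k 1/k∈μa = ℚ.<-irrefl refl (proj₁ normalized 1ℚ
        (subst (cut (μ ⊤)) (suc-/suc k) (μ-r-large 1/k∈μa k 0)))

      disjoint⇒≤r : ∀ {u} → (∀ n → u ∧ a n ≈ ⊥) → ∀ n → u ≤ r n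
      disjoint⇒≤r disjoint zero    = x≤⊤ _
      disjoint⇒≤r disjoint (suc n) = ∧-greatest (disjoint⇒≤r disjoint n) (disjoint⇒≤∁ (disjoint n))

      disjoint⇒≈⊥ : ∀ {u} → (∀ n → u ∧ a n ≈ ⊥) → u ≈ ⊥
      disjoint⇒≈⊥ {u} disjoint = decidable-stable em λ u≉⊥ →
        let d , d-candidate = candidate u u≉⊥
            k , 1/k∈μd = unitFraction-cut (proj₁ d-candidate)
        in a-not-all-large k λ n →
             proj₂ (proj₂ (chosen n)) d k (candidate-mono (disjoint⇒≤r disjoint n) d-candidate) 1/k∈μd

      a-partition : IsPartitionOfUnity a
      a-partition = record
        { nonzero  = proj₁ ∘ a-candidate
        ; disjoint = a-disjoint
        -- The complement of an upper bound is disjoint from every `a n`, hence zero.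
        ; supremum = (λ i → x≤⊤ (a i)) , λ u a≤u → ∖≈⊥⇒≤
            (disjoint⇒≈⊥ λ n → disjoint-mono (x∧y≤y ⊤ (∁ u)) (a≤u n) (∧-complementˡ u))
        }

      homogeneous-partition : ∃ λ (a : ℕ → Carrier) →
        IsPartitionOfUnity a × (∀ n b → b ≉ ⊥ → b ≤ a n → SameUr m b (a n))
      homogeneous-partition = a , a-partition , λ n b b≉⊥ b≤an →
        let an≉⊥ , _ , _ , hom = a-candidate n
        in Homogeneous⇒SameUr an≉⊥ b≉⊥ b≤an hom

lemma5p1 : (∀ {ℓ} → ExcludedMiddle ℓ) →
    (∀ {a ℓ₁ b ℓ₂ r} → AxiomOfChoice a ℓ₁ b ℓ₂ r) →
    ∀ {c ℓ} (𝔅 : BooleanAlgebra c ℓ) (μ : Measure 𝔅) →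
    let open BooleanAlgebra 𝔅 in
    let open Order 𝔅 in
    NonAtomic μ → StrictlyPositive μ →
    ∃ λ (a : ℕ → Carrier) →
    IsPartitionOfUnity a ×
    (∀ n b → b ≉ ⊥ → b ≤ a n → SameUr μ b (a n))
lemma5p1 = homogeneous-partition
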